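{- Let $G$ be a graph and let $F:V(G)\to 2^{\mathbb Z}$ be an assignment of forbidden imbalances. Suppose that there exist an ordering $v_1,\dots,v_n$ of $V(G)$ and a spanning subgraph $H$ of $G$ such that for each vertex $v\in V(G)$, \[|F(v)|\le \deg^L_G(v)-2\deg^L_H(v)+\deg^R_H(v).\] Then $G$ has an $F$-avoiding orientation (in the imbalance sense). The same conclusion also holds when $F$ is interpreted as a set of forbidden out-degrees, i.e. there is an orientation $D$ with $\deg_D^+(v)\notin F(v)$ for all $v$.
   Context: Given an ordering $v_1,\dots,v_n$ of $V(G)$ and a subgraph $H$ of $G$ (with $H=G$ allowed), $\deg^L_H(v_i)$ is the number of edges $v_iv_j\in E(H)$ with $j<i$, and $\deg^R_H(v_i)$ is the number of edges $v_iv_j\in E(H)$ with $j>i$. For an orientation $D$ of $G$, the imbalance of $v$ is $\deg^+_D(v)-\deg^-_D(v)$ (out-degree minus in-degree), and $D$ is $F$-avoiding if $\deg^+_D(v)-\deg^-_D(v)\notin F(v)$ for every $v\in V(G)$. -}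

module Defs where

open import Data.Bool using (Bool; true; false; not; _∧_)
open import Data.Nat using (ℕ; _<ᵇ_)
open import Data.Fin using (Fin; toℕ)
open import Data.List using (List; length; filterᵇ; allFin)
open import Data.Integer using (ℤ; +_; _-_)
open import Relation.Binary.PropositionalEquality using (_≡_)

record SimpleGraph (n : ℕ) : Set where
  field
    adj   : Fin n → Fin n → Bool
    sym   : ∀ u v → adj u v ≡ adj v u
    irrfl : ∀ v → adj v v ≡ false
open SimpleGraph public

count : ∀ {n} → (Fin n → Bool) → ℕ
count {n} p = length (filterᵇ p (allFin n))

IsSpanningSubgraph : ∀ {n} → SimpleGraph n → SimpleGraph n → Set
IsSpanningSubgraph H G = ∀ u v → adj H u v ≡ true → adj G u v ≡ true

-- An orientation D of G: D u v = true means the edge uv is directed u → v.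
-- Every edge gets exactly one direction, and only edges are directed.
record IsOrientation {n} (G : SimpleGraph n) (D : Fin n → Fin n → Bool) : Set where
  field
    onEdges : ∀ u v → D u v ≡ true → adj G u v ≡ true
    exactlyOne : ∀ u v → adj G u v ≡ true → D u v ≡ not (D v u)

outdeg : ∀ {n} → (Fin n → Fin n → Bool) → Fin n → ℕ
outdeg D v = count (λ u → D v u)

indeg : ∀ {n} → (Fin n → Fin n → Bool) → Fin n → ℕ
indeg D v = count (λ u → D u v)

imbalance : ∀ {n} → (Fin n → Fin n → Bool) → Fin n → ℤ
imbalance D v = + outdeg D v - + indeg D v

-- The ordering v_1,…,v_n is given by a position map pos (a bijection);
-- vertex v is v_i with i = pos v.
degL : ∀ {n} → (Fin n → Fin n) → SimpleGraph n → Fin n → ℕ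
degL pos H v = count (λ u → adj H v u ∧ (toℕ (pos u) <ᵇ toℕ (pos v)))

degR : ∀ {n} → (Fin n → Fin n) → SimpleGraph n → Fin n → ℕ
degR pos H v = count (λ u → adj H v u ∧ (toℕ (pos v) <ᵇ toℕ (pos u)))

{-# OPTIONS --safe #-}
-- Give every edge e a variable xₑ and let dᵥ be the sum of xₑ over the edges to the left of v
-- minus the sum over the edges to its right; up to a factor 2 and a constant, this is the
-- imbalance as well as the out-degree of v. By the Combinatorial Nullstellensatz it suffices that
-- ∏ᵥ dᵥ^|F(v)| has a squarefree monomial with nonzero coefficient.
--
-- Remove the last vertex v, with left neighbourhood N and left H-neighbourhood h. The coefficient
-- of ∏ x_{uv}, over the u ∈ h with F(u) ≠ ∅, in ∏_{u ≠ v} dᵤ^|F(u)| is, up to a nonzero factor, the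
-- same product for the remaining graph with |F(u)| decreased by one at these u, so it is nonzero
-- by induction. The last factor is dᵥ^|F(v)| with dᵥ = Σ_{u ∈ N} x_{uv}. Unless F(v) = ∅,
-- multiplication by it is injective on squarefree forms of degree t ≤ |h| in the x_{uv}, because
-- 2t + |F(v)| ≤ |N|.
module Submission where

open import Defs
open import Data.Nat using (ℕ)
open import Data.Fin using (Fin)
open import Data.Bool using (Bool)
open import Data.List using (List; length)
open import Data.List.Relation.Unary.Unique.Propositional using (Unique)
open import Data.List.Membership.Propositional using (_∉_)
open import Data.Integer using (ℤ; +_; _-_; _+_; _*_; _≤_)
open import Data.Product using (Σ; _×_; ∃-syntax)
open import Function.Bundles using (_⤖_; Bijection)

open import Data.Nat as ℕ using (zero; suc; z≤n; s≤s; _∸_; _<ᵇ_)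
import Data.Nat.Properties as ℕₚ
import Data.Nat.Tactic.RingSolver as ℕ-Solver
open import Data.Fin using (zero; suc; toℕ; opposite)
open import Data.Fin.Properties using (opposite-prop; toℕ<n)
open import Data.Fin.Permutation as Perm using (Permutation; _⟨$⟩ʳ_; _⟨$⟩ˡ_; _∘ₚ_)
open import Data.Integer using (0ℤ; 1ℤ; -_; _≟_)
import Data.Integer.Properties as ℤₚ
open import Data.Integer.Tactic.RingSolver using (solve-∀)
open import Data.Bool using (true; false; not; _∧_)
open import Data.Bool.Properties using (∧-comm; not-involutive; T-≡; ⇔→≡)
open import Data.List as List using ([]; _∷_; filterᵇ)
open import Data.List.Relation.Unary.Any using (here; there)
open import Data.Vec as Vec using (Vec; []; _∷_; lookup; tabulate)
open import Data.Vec.Properties using (lookup∘tabulate)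
open import Data.Product using (_,_; proj₁; proj₂)
open import Data.Sum using (_⊎_; inj₁; inj₂)
open import Data.Unit using (⊤; tt)
open import Data.Empty using (⊥-elim)
open import Function using (_∘_; _$_; id; mk⇔)
open import Function.Bundles using (module Equivalence)
open import Function.Properties.Bijection using (⤖⇒↔)
open import Relation.Nullary using (yes; no)
open import Relation.Nullary.Decidable using (decidable-stable)
open import Relation.Binary.PropositionalEquality as ≡
  using (_≡_; _≢_; refl; cong; cong₂; module ≡-Reasoning)
open import Algebra.Properties.AbelianGroup ℤₚ.+-0-abelianGroup using (identityʳ-unique)
open import Algebra.Properties.CommutativeMonoid.Sum ℕₚ.+-0-commutativeMonoid
  using (sum-cong-≗; sum-permute; sum-replicate-zero; ∑-distrib-+) renaming (sum to ∑)

private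
  variable
    n : ℕ
    N : Vec Bool n

-- Squarefree forms in the edges of a row

-- A set of edges among those marked in `N`, standing for a squarefree monomial; `skip` passes over
-- a non-edge.
data Sub : Vec Bool n → Set where
  ∅    : Sub []
  skip : Sub N → Sub (false ∷ N)
  pick : Bool → Sub N → Sub (true ∷ N)

bit : Bool → ℕ
bit true  = 1
bit false = 0

size : Sub N → ℕ
size ∅          = 0
size (skip S)   = size S
size (pick b S) = bit b ℕ.+ size S

full : Vec Bool n → ℕ
full []      = 0
full (b ∷ N) = bit b ℕ.+ full N

-- below s g B is the sum of g S over the S ⊆ B with |S| + s = |B|, that is, the divided
-- power ℓˢ / s! of ℓ = Σₑ xₑ applied to the squarefree form with coefficients g.
below : ℕ → (Sub N → ℤ) → Sub N → ℤ
below s       g (skip B)       = below s (g ∘ skip) B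
below s       g (pick false B) = below s (g ∘ pick false) B
below zero    g ∅              = g ∅
below (suc s) g ∅              = 0ℤ
below zero    g (pick true B)  = below zero (g ∘ pick true) B
below (suc s) g (pick true B)  = below (suc s) (g ∘ pick true) B + below s (g ∘ pick false) B

-- Multiplication by ℓ itself, that is, `below 1` with `below 0 g` simplified to `g`.
below₁ : (Sub N → ℤ) → Sub N → ℤ
below₁ g ∅              = 0ℤ
below₁ g (skip B)       = below₁ (g ∘ skip) B
below₁ g (pick false B) = below₁ (g ∘ pick false) B
below₁ g (pick true B)  = below₁ (g ∘ pick true) B + g (pick false B)

below-zero : ∀ (g : Sub N → ℤ) B → below 0 g B ≡ g B
below-zero g ∅              = refl
below-zero g (skip B)       = below-zero (g ∘ skip) B
below-zero g (pick false B) = below-zero (g ∘ pick false) B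
below-zero g (pick true B)  = below-zero (g ∘ pick true) B

-- Multiplication by ℓˢ raises the degree by s, so only the coefficients of degree |B| - s enter.
below-≡0 : ∀ s (g : Sub N → ℤ) B → (∀ S → s ℕ.+ size S ≡ size B → g S ≡ 0ℤ) → below s g B ≡ 0ℤ
below-≡0 zero    g ∅              h = h ∅ refl
below-≡0 (suc s) g ∅              h = refl
below-≡0 s       g (skip B)       h = below-≡0 s (g ∘ skip) B (h ∘ skip)
below-≡0 s       g (pick false B) h = below-≡0 s (g ∘ pick false) B (h ∘ pick false)
below-≡0 zero    g (pick true B)  h =
  below-≡0 zero (g ∘ pick true) B (λ S e → h (pick true S) (cong suc e))
below-≡0 (suc s) g (pick true B)  h = cong₂ _+_
  (below-≡0 (suc s) (g ∘ pick true) B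
    (λ S e → h (pick true S) (≡.trans (ℕₚ.+-suc (suc s) (size S)) (cong suc e))))
  (below-≡0 s (g ∘ pick false) B (λ S e → h (pick false S) (cong suc e)))

below-neg : ∀ s (g h : Sub N → ℤ) B → (∀ S → g S ≡ - h S) → below s g B ≡ - below s h B
below-neg zero    g h ∅              e = e ∅
below-neg (suc s) g h ∅              e = refl
below-neg s       g h (skip B)       e = below-neg s (g ∘ skip) (h ∘ skip) B (e ∘ skip)
below-neg s       g h (pick false B) e =
  below-neg s (g ∘ pick false) (h ∘ pick false) B (e ∘ pick false)
below-neg zero    g h (pick true B)  e =
  below-neg zero (g ∘ pick true) (h ∘ pick true) B (e ∘ pick true)
below-neg (suc s) g h (pick true B)  e = ≡.trans
  (cong₂ _+_
    (below-neg (suc s) (g ∘ pick true) (h ∘ pick true) B (e ∘ pick true))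
    (below-neg s (g ∘ pick false) (h ∘ pick false) B (e ∘ pick false)))
  (≡.sym (ℤₚ.neg-distrib-+ (below (suc s) (h ∘ pick true) B) (below s (h ∘ pick false) B)))

below₁-+ : ∀ (g h : Sub N → ℤ) B → below₁ (λ S → g S + h S) B ≡ below₁ g B + below₁ h B
below₁-+ g h ∅              = refl
below₁-+ g h (skip B)       = below₁-+ (g ∘ skip) (h ∘ skip) B
below₁-+ g h (pick false B) = below₁-+ (g ∘ pick false) (h ∘ pick false) B
below₁-+ g h (pick true B)
  rewrite below₁-+ (g ∘ pick true) (h ∘ pick true) B =
  interchange (below₁ (g ∘ pick true) B) (below₁ (h ∘ pick true) B) (g (pick false B)) (h (pick false B))
  where
  interchange : ∀ a b c d → (a + b) + (c + d) ≡ (a + c) + (b + d)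
  interchange = solve-∀

below₁-≡0 : ∀ (g : Sub N → ℤ) B → (∀ S → suc (size S) ≡ size B → g S ≡ 0ℤ) → below₁ g B ≡ 0ℤ
below₁-≡0 g ∅              h = refl
below₁-≡0 g (skip B)       h = below₁-≡0 (g ∘ skip) B (h ∘ skip)
below₁-≡0 g (pick false B) h = below₁-≡0 (g ∘ pick false) B (h ∘ pick false)
below₁-≡0 g (pick true B)  h = cong₂ _+_
  (below₁-≡0 (g ∘ pick true) B (λ S e → h (pick true S) (cong suc e)))
  (h (pick false B) refl)

-- This is ℓ · ℓˢ / s! = (s + 1) · ℓˢ⁺¹ / (s + 1)!: a subset missing s + 1 elements of B is counted
-- once for each choice of the missing element that goes first.
below₁-below : ∀ s (g : Sub N → ℤ) B → below₁ (below s g) B ≡ + suc s * below (suc s) g B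
below₁-below s       g ∅              = ≡.sym (ℤₚ.*-zeroʳ (+ suc s))
below₁-below s       g (skip B)       = below₁-below s (g ∘ skip) B
below₁-below s       g (pick false B) = below₁-below s (g ∘ pick false) B
below₁-below zero    g (pick true B)
  rewrite below₁-below zero (g ∘ pick true) B =
  distrib (below 1 (g ∘ pick true) B) (below 0 (g ∘ pick false) B)
  where
  distrib : ∀ a b → 1ℤ * a + b ≡ 1ℤ * (a + b)
  distrib = solve-∀
below₁-below (suc s) g (pick true B)
  rewrite below₁-+ (below (suc s) (g ∘ pick true)) (below s (g ∘ pick false)) B
        | below₁-below (suc s) (g ∘ pick true) B
        | below₁-below s (g ∘ pick false) B =
  distrib (+ suc s) (below (suc (suc s)) (g ∘ pick true) B) (below (suc s) (g ∘ pick false) B)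
  where
  distrib : ∀ k a b → ((1ℤ + k) * a + k * b) + b ≡ (1ℤ + k) * (a + b)
  distrib = solve-∀

a+b≡0⇒a≡0⇒b≡0 : ∀ {a b} → a + b ≡ 0ℤ → a ≡ 0ℤ → b ≡ 0ℤ
a+b≡0⇒a≡0⇒b≡0 {b = b} e refl = ≡.trans (≡.sym (ℤₚ.+-identityˡ b)) e

-- If 2t + s ≤ |N|, then ℓˢ is injective on squarefree forms of degree t (the hard Lefschetz
-- property of the Boolean lattice). On g = g₀ + x g₁ the hypothesis says ℓˢ g₀ = 0 and
-- ℓˢ g₁ + s ℓˢ⁻¹ g₀ = 0, so ℓˢ⁺¹ g₁ = 0; hence g₁ = 0, then ℓˢ⁻¹ g₀ = 0 and g₀ = 0.
below-injective : ∀ s t (g : Sub N → ℤ) → t ℕ.+ (t ℕ.+ s) ℕ.≤ full N →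
  (∀ B → size B ≡ s ℕ.+ t → below s g B ≡ 0ℤ) → ∀ S → size S ≡ t → g S ≡ 0ℤ
below-injective zero t g le h S e = ≡.trans (≡.sym (below-zero g S)) (h S e)
below-injective (suc s) (suc t) g () h ∅ e
below-injective (suc s) t g le h (skip S) e =
  below-injective (suc s) t (g ∘ skip) le (h ∘ skip) S e
-- The row shortens in both recursive calls, so the power may grow from s + 1 to s + 2 in the one
-- for g₁.
below-injective {N = true ∷ N} (suc s) t g le h (pick b S) = pick-case b
  where
  g₀ g₁ : Sub N → ℤ
  g₀ = g ∘ pick false
  g₁ = g ∘ pick true

  split : ∀ B → size B ≡ s ℕ.+ t → below (suc s) g₁ B + below s g₀ B ≡ 0ℤ
  split B e = h (pick true B) (cong suc e)

  g₁≡0 : ∀ u → suc u ≡ t → ∀ S → size S ≡ u → g₁ S ≡ 0ℤ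
  g₁≡0 u refl = below-injective (suc (suc s)) u g₁ bound λ B e →
    ℤₚ.*-cancelˡ-≡ (+ suc (suc s)) (below (suc (suc s)) g₁ B) 0ℤ $ begin
      + suc (suc s) * below (suc (suc s)) g₁ B  ≡⟨ below₁-below (suc s) g₁ B ⟨
      below₁ (below (suc s) g₁) B               ≡⟨ ℤₚ.+-identityʳ _ ⟨
      below₁ (below (suc s) g₁) B + 0ℤ
        ≡⟨ cong (λ z → below₁ (below (suc s) g₁) B + z) (g₀-vanishes B e) ⟨
      below₁ (below (suc s) g₁) B + below₁ (below s g₀) B
        ≡⟨ below₁-+ (below (suc s) g₁) (below s g₀) B ⟨
      below₁ (λ S → below (suc s) g₁ S + below s g₀ S) B
        ≡⟨ below₁-≡0 _ B (λ S e′ → split S (ℕₚ.suc-injective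
             (≡.trans e′ (≡.trans e (cong suc (≡.sym (ℕₚ.+-suc s u))))))) ⟩
      0ℤ                                        ≡⟨ ℤₚ.*-zeroʳ (+ suc (suc s)) ⟨
      + suc (suc s) * 0ℤ                        ∎
    where
    open ≡-Reasoning
    -- 2(u + 1) + (s + 1) ≤ |N| + 1 amounts to 2u + (s + 2) ≤ |N|: the drop in degree pays for the
    -- higher power and the lost edge.
    bound : u ℕ.+ (u ℕ.+ suc (suc s)) ℕ.≤ full N
    bound = ℕₚ.≤-trans (ℕₚ.≤-reflexive (cong (u ℕ.+_) (ℕₚ.+-suc u (suc s)))) (ℕ.s≤s⁻¹ le)
    -- On sets without the first edge `h` says ℓˢ⁺¹ g₀ = 0, and up to a factor this is ℓ · ℓˢ g₀.
    g₀-vanishes : ∀ B → size B ≡ suc (suc s) ℕ.+ u → below₁ (below s g₀) B ≡ 0ℤ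
    g₀-vanishes B e = ≡.trans (below₁-below s g₀ B)
      (≡.trans (cong (λ z → + suc s * z) (h (pick false B) (≡.trans e (cong suc (≡.sym (ℕₚ.+-suc s u))))))
        (ℤₚ.*-zeroʳ (+ suc s)))

  below-g₁≡0 : ∀ u → u ≡ t → ∀ B → size B ≡ s ℕ.+ u → below (suc s) g₁ B ≡ 0ℤ
  -- For t = 0 the form g₁ would have degree -1: no set has s + 1 elements fewer than B, as |B| = s.
  below-g₁≡0 zero    _ B e = below-≡0 (suc s) g₁ B λ S e′ → ⊥-elim
    (ℕₚ.m+1+n≢m s (≡.trans (ℕₚ.+-suc s (size S)) (≡.trans e′ (≡.trans e (ℕₚ.+-identityʳ s)))))
  below-g₁≡0 (suc u) p B e = below-≡0 (suc s) g₁ B λ S e′ →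
    g₁≡0 u p S (ℕₚ.+-cancelˡ-≡ (suc s) (size S) u (≡.trans e′ (≡.trans e (ℕₚ.+-suc s u))))

  g₀≡0 : ∀ S → size S ≡ t → g₀ S ≡ 0ℤ
  g₀≡0 = below-injective s t g₀ bound λ B e → a+b≡0⇒a≡0⇒b≡0 (split B e) (below-g₁≡0 t refl B e)
    where
    bound : t ℕ.+ (t ℕ.+ s) ℕ.≤ full N
    bound = ℕ.s≤s⁻¹ (ℕₚ.≤-trans
      (ℕₚ.≤-reflexive (≡.sym (≡.trans (cong (t ℕ.+_) (ℕₚ.+-suc t s)) (ℕₚ.+-suc t (t ℕ.+ s))))) le)

  pick-case : ∀ b → size (pick b S) ≡ t → g (pick b S) ≡ 0ℤ
  pick-case false e = g₀≡0 S e
  pick-case true  e = g₁≡0 (size S) e S refl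

-- A finite search; it turns the injectivity of ℓˢ into an explicit monomial with nonzero
-- coefficient.
nonzero-or-zero : ∀ (g : Sub N → ℤ) k →
  (∃[ B ] (size B ≡ k × g B ≢ 0ℤ)) ⊎ (∀ B → size B ≡ k → g B ≡ 0ℤ)
nonzero-or-zero {N = []} g k with g ∅ ≟ 0ℤ | k
... | yes e | _     = inj₂ λ { ∅ _ → e }
... | no ne | zero  = inj₁ (∅ , refl , ne)
... | no ne | suc _ = inj₂ λ { ∅ () }
nonzero-or-zero {N = false ∷ N} g k with nonzero-or-zero (g ∘ skip) k
... | inj₁ (B , e , ne) = inj₁ (skip B , e , ne)
... | inj₂ z            = inj₂ λ { (skip B) → z B }
nonzero-or-zero {N = true ∷ N} g zero with nonzero-or-zero (g ∘ pick false) zero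
... | inj₁ (B , e , ne) = inj₁ (pick false B , e , ne)
... | inj₂ z            = inj₂ λ { (pick false B) → z B ; (pick true B) () }
nonzero-or-zero {N = true ∷ N} g (suc k)
  with nonzero-or-zero (g ∘ pick false) (suc k) | nonzero-or-zero (g ∘ pick true) k
... | inj₁ (B , e , ne) | _                 = inj₁ (pick false B , e , ne)
... | inj₂ _            | inj₁ (B , e , ne) = inj₁ (pick true B , cong suc e , ne)
... | inj₂ z₀           | inj₂ z₁           =
  inj₂ λ { (pick false B) → z₀ B ; (pick true B) → z₁ B ∘ ℕₚ.suc-injective }

below-nonzero : ∀ s (g : Sub N → ℤ) S → size S ℕ.+ (size S ℕ.+ s) ℕ.≤ full N → g S ≢ 0ℤ →
  ∃[ B ] below s g B ≢ 0ℤ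
below-nonzero s g S le ne with nonzero-or-zero (below s g) (s ℕ.+ size S)
... | inj₁ (B , _ , nz) = B , nz
... | inj₂ z            = ⊥-elim (ne (below-injective s (size S) g le z S refl))

-- Coefficients of the product of the linear forms

-- The vertex added by _◃_ comes after all the others in the ordering of the theorem; its row
-- records the edges to its left neighbours.
data Graph : ℕ → Set where
  ∅   : Graph 0
  _◃_ : Vec Bool n → Graph n → Graph (suc n)

data Subgraph : Graph n → Set where
  ∅   : Subgraph ∅
  _◃_ : ∀ {G : Graph n} → Sub N → Subgraph G → Subgraph (N ◃ G)

private
  variable
    G : Graph n

-- The signed value of k at f − 1_S, and 0 if f vanishes somewhere on S.
debit : Vec ℕ n → (Vec ℕ n → ℤ) → {N : Vec Bool n} → Sub N → ℤ
debit []          k ∅              = k []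
debit (x ∷ f)     k (skip S)       = debit f (k ∘ (x ∷_)) S
debit (x ∷ f)     k (pick false S) = debit f (k ∘ (x ∷_)) S
debit (zero ∷ f)  k (pick true S)  = 0ℤ
debit (suc x ∷ f) k (pick true S)  = - debit f (k ∘ (x ∷_)) S

-- The coefficient of the monomial ∏_{e ∈ M} xₑ in ∏ᵥ dᵥ^{fᵥ} / fᵥ!, where dᵥ is the sum of xₑ over
-- the edges e to the left of v minus the sum over the edges to the right of v.
coef : {G : Graph n} → Subgraph G → Vec ℕ n → ℤ
coef ∅       []      = 1ℤ
coef (B ◃ M) (a ∷ f) = below a (debit f (coef M)) B

lower : Vec ℕ n → {N : Vec Bool n} → Sub N → Vec ℕ n
lower []      ∅          = []
lower (x ∷ f) (skip S)   = x ∷ lower f S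
lower (x ∷ f) (pick b S) = x ∸ bit b ∷ lower f S

-- The degree condition in inductive form: when a vertex becomes the last one, each of its right
-- H-neighbours has lowered its exponent by one. If 2|h| exceeds |N|, truncation forces the exponent
-- to be 0.
Small : {G : Graph n} → Subgraph G → Vec ℕ n → Set
Small ∅                 []      = ⊤
Small (_◃_ {N = N} h H) (a ∷ f) = a ℕ.≤ full N ∸ (size h ℕ.+ size h) × Small H (lower f h)

-- A vertex with exponent 0 cannot give up a factor for its edge, so that edge is left out of the
-- monomial.
restrict : Vec ℕ n → {N : Vec Bool n} → Sub N → Sub N
restrict []          ∅              = ∅
restrict (x ∷ f)     (skip S)       = skip (restrict f S)
restrict (x ∷ f)     (pick false S) = pick false (restrict f S)
restrict (zero ∷ f)  (pick true S)  = pick false (restrict f S)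
restrict (suc x ∷ f) (pick true S)  = pick true (restrict f S)

size-restrict : ∀ (f : Vec ℕ n) {N} (S : Sub N) → size (restrict f S) ℕ.≤ size S
size-restrict []          ∅              = z≤n
size-restrict (x ∷ f)     (skip S)       = size-restrict f S
size-restrict (x ∷ f)     (pick false S) = size-restrict f S
size-restrict (zero ∷ f)  (pick true S)  = ℕₚ.m≤n⇒m≤1+n (size-restrict f S)
size-restrict (suc x ∷ f) (pick true S)  = s≤s (size-restrict f S)

-- The two values agree up to sign: `restrict` avoids the zero clause of `debit` exactly where the
-- truncated subtraction in `lower` changes nothing.
debit-restrict : ∀ (f : Vec ℕ n) k {N} (S : Sub N) →
  k (lower f S) ≢ 0ℤ → debit f k (restrict f S) ≢ 0ℤ
debit-restrict []          k ∅              ne = ne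
debit-restrict (x ∷ f)     k (skip S)       ne = debit-restrict f (k ∘ (x ∷_)) S ne
debit-restrict (x ∷ f)     k (pick false S) ne = debit-restrict f (k ∘ (x ∷_)) S ne
debit-restrict (zero ∷ f)  k (pick true S)  ne = debit-restrict f (k ∘ (0 ∷_)) S ne
debit-restrict (suc x ∷ f) k (pick true S)  ne =
  debit-restrict f (k ∘ (x ∷_)) S ne ∘ ℤₚ.neg-injective

exists-coef≢0 : ∀ (H : Subgraph G) f → Small H f → ∃[ M ] coef {G = G} M f ≢ 0ℤ
exists-coef≢0 ∅ [] _ = ∅ , λ ()
exists-coef≢0 (_◃_ {N = N} h H) (a ∷ f) (le , small) with exists-coef≢0 H (lower f h) small
... | M , ne = let B , nz = top a le in B ◃ M , nz
  where
  S₀ : Sub N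
  S₀ = restrict f h

  g : Sub N → ℤ
  g = debit f (coef M)

  g≢0 : g S₀ ≢ 0ℤ
  g≢0 = debit-restrict f (coef M) h ne

  top : ∀ a → a ℕ.≤ full N ∸ (size h ℕ.+ size h) → ∃[ B ] below a g B ≢ 0ℤ
  -- The last factor is 1 here and 2|h| ≤ |N| may fail, but `S₀` itself already has a nonzero
  -- coefficient.
  top zero    _  = S₀ , λ e → g≢0 (≡.trans (≡.sym (below-zero g S₀)) e)
  top (suc a) le = below-nonzero (suc a) g S₀ bound g≢0
    where
    open ℕₚ.≤-Reasoning
    2h≤N : size h ℕ.+ size h ℕ.≤ full N
    2h≤N = ℕₚ.<⇒≤ (ℕₚ.m∸n≢0⇒n<m (ℕₚ.m<n⇒n≢0 le))
    bound : size S₀ ℕ.+ (size S₀ ℕ.+ suc a) ℕ.≤ full N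
    bound = begin
      size S₀ ℕ.+ (size S₀ ℕ.+ suc a)  ≤⟨ ℕₚ.+-mono-≤ (size-restrict f h)
                                            (ℕₚ.+-monoˡ-≤ (suc a) (size-restrict f h)) ⟩
      size h ℕ.+ (size h ℕ.+ suc a)    ≡⟨ ℕₚ.+-assoc (size h) (size h) (suc a) ⟨
      size h ℕ.+ size h ℕ.+ suc a      ≡⟨ ℕₚ.+-comm (size h ℕ.+ size h) (suc a) ⟩
      suc a ℕ.+ (size h ℕ.+ size h)    ≤⟨ ℕₚ.m≤o∸n⇒m+n≤o (suc a) 2h≤N le ⟩
      full N                           ∎

debit-≡0 : ∀ (f : Vec ℕ n) k {N} (S : Sub N) →
  (∀ f′ → Vec.sum f′ ℕ.+ size S ≡ Vec.sum f → k f′ ≡ 0ℤ) → debit f k S ≡ 0ℤ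
debit-≡0 []      k ∅          h = h [] refl
debit-≡0 (x ∷ f) k (skip S)   h = debit-≡0 f (k ∘ (x ∷_)) S λ f′ e →
  h (x ∷ f′) (≡.trans (ℕₚ.+-assoc x (Vec.sum f′) (size S)) (cong (x ℕ.+_) e))
debit-≡0 (x ∷ f) k (pick false S) h = debit-≡0 f (k ∘ (x ∷_)) S λ f′ e →
  h (x ∷ f′) (≡.trans (ℕₚ.+-assoc x (Vec.sum f′) (size S)) (cong (x ℕ.+_) e))
debit-≡0 (zero ∷ f)  k (pick true S) h = refl
debit-≡0 (suc x ∷ f) k (pick true S) h = cong (λ z → - z) $ debit-≡0 f (k ∘ (x ∷_)) S λ f′ e →
  h (x ∷ f′) (≡.trans (ℕₚ.+-suc (x ℕ.+ Vec.sum f′) (size S))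
    (cong suc (≡.trans (ℕₚ.+-assoc x (Vec.sum f′) (size S)) (cong (x ℕ.+_) e))))

edges : Subgraph G → ℕ
edges ∅       = 0
edges (B ◃ M) = size B ℕ.+ edges M

-- The product is homogeneous of degree Σ fᵥ, so every monomial in it has that many edges.
coef-≡0 : ∀ {G : Graph n} (M : Subgraph G) f → Vec.sum f ≢ edges M → coef M f ≡ 0ℤ
coef-≡0 ∅       []      ne = ⊥-elim (ne refl)
coef-≡0 (B ◃ M) (a ∷ f) ne = below-≡0 a (debit f (coef M)) B λ S eS →
  debit-≡0 f (coef M) S λ f′ ef → coef-≡0 M f′ λ e → ne (begin
    a ℕ.+ Vec.sum f                     ≡⟨ cong (a ℕ.+_) (≡.trans (ℕₚ.+-comm (size S) (Vec.sum f′)) ef) ⟨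
    a ℕ.+ (size S ℕ.+ Vec.sum f′)       ≡⟨ ℕₚ.+-assoc a (size S) (Vec.sum f′) ⟨
    a ℕ.+ size S ℕ.+ Vec.sum f′         ≡⟨ cong₂ ℕ._+_ eS e ⟩
    size B ℕ.+ edges M              ∎)
  where open ≡-Reasoning

coef≢0⇒sum≡edges : ∀ {G : Graph n} (M : Subgraph G) f → coef M f ≢ 0ℤ → Vec.sum f ≡ edges M
coef≢0⇒sum≡edges M f ne = decidable-stable (Vec.sum f ℕₚ.≟ edges M) (ne ∘ coef-≡0 M f)

-- The Combinatorial Nullstellensatz

Sequence : Set
Sequence = ℕ → ℤ

shift Δ : Sequence → Sequence
shift q t = q (suc t)
Δ q t     = q (suc t) - q t

-- q is a polynomial of degree at most d with d! times its t^d-coefficient equal to γ.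
HasDegree : Sequence → ℕ → ℤ → Set
HasDegree q zero    γ = ∀ t → q t ≡ γ
HasDegree q (suc d) γ = HasDegree (Δ q) d γ

shift-degree : ∀ q d {γ} → HasDegree q d γ → HasDegree (shift q) d γ
shift-degree q zero    h = h ∘ suc
shift-degree q (suc d) h = shift-degree (Δ q) d h

data Degrees : Vec Sequence n → Vec ℕ n → ℤ → Set where
  []  : Degrees [] [] 1ℤ
  _∷_ : ∀ {q d γ} {qs : Vec Sequence n} {ds δ} →
        HasDegree q d γ → Degrees qs ds δ → Degrees (q ∷ qs) (d ∷ ds) (γ * δ)

Functional : ℕ → Set
Functional n = Vec Sequence n → ℤ

-- Out-degrees are accumulated by shifting the sequence at the tail of each edge, which is why `q`
-- is finally read at 0. An edge in B contributes its leftward direction minus its rightward one; an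
-- edge outside B leaves the left neighbour.
alternateRow : {N : Vec Bool n} → Sub N → Sequence → Vec Sequence n → Functional n → ℤ
alternateRow ∅              q []      κ = q 0 * κ []
alternateRow (skip B)       q (p ∷ r) κ = alternateRow B q r (κ ∘ (p ∷_))
alternateRow (pick false B) q (p ∷ r) κ = alternateRow B q r (κ ∘ (shift p ∷_))
alternateRow (pick true B)  q (p ∷ r) κ =
  alternateRow B (shift q) r (κ ∘ (p ∷_)) - alternateRow B q r (κ ∘ (shift p ∷_))

-- The signed sum of ∏ᵥ qᵥ(deg⁺ v) over the orientations of G in which the edges outside M point
-- to the right.
alternate : {G : Graph n} → Subgraph G → Functional n
alternate ∅       []      = 1ℤ
alternate (B ◃ M) (q ∷ r) = alternateRow B q r (alternate M)

data Split : Vec Sequence n → Vec Sequence n → Vec Sequence n → Set where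
  here  : ∀ {q q₁ q₂} {r : Vec Sequence n} → (∀ t → q t ≡ q₁ t + q₂ t) →
          Split (q ∷ r) (q₁ ∷ r) (q₂ ∷ r)
  there : ∀ {q} {r r₁ r₂ : Vec Sequence n} → Split r r₁ r₂ → Split (q ∷ r) (q ∷ r₁) (q ∷ r₂)

Multilinear : Functional n → Set
Multilinear κ = ∀ {r r₁ r₂} → Split r r₁ r₂ → κ r ≡ κ r₁ + κ r₂

+-interchange-- : ∀ a b c d → (a + b) - (c + d) ≡ (a - c) + (b - d)
+-interchange-- = solve-∀

alternateRow-+ˢ : ∀ {N : Vec Bool n} (B : Sub N) {q q₁ q₂} r (κ : Functional n) →
  (∀ t → q t ≡ q₁ t + q₂ t) →
  alternateRow B q r κ ≡ alternateRow B q₁ r κ + alternateRow B q₂ r κ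
alternateRow-+ˢ ∅ {q} {q₁} {q₂} [] κ h rewrite h 0 = ℤₚ.*-distribʳ-+ (κ []) (q₁ 0) (q₂ 0)
alternateRow-+ˢ (skip B)       (p ∷ r) κ h = alternateRow-+ˢ B r _ h
alternateRow-+ˢ (pick false B) (p ∷ r) κ h = alternateRow-+ˢ B r _ h
alternateRow-+ˢ (pick true B) {q} {q₁} {q₂}  (p ∷ r) κ h = ≡.trans
  (cong₂ _-_ (alternateRow-+ˢ B r _ (h ∘ suc)) (alternateRow-+ˢ B r _ h))
  (+-interchange-- (alternateRow B (shift q₁) r _) (alternateRow B (shift q₂) r _)
                   (alternateRow B q₁ r _) (alternateRow B q₂ r _))

alternateRow-+ᶠ : ∀ {N : Vec Bool n} (B : Sub N) q r {κ κ₁ κ₂ : Functional n} →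
  (∀ s → κ s ≡ κ₁ s + κ₂ s) →
  alternateRow B q r κ ≡ alternateRow B q r κ₁ + alternateRow B q r κ₂
alternateRow-+ᶠ ∅ q [] {κ₁ = κ₁} {κ₂} h rewrite h [] = ℤₚ.*-distribˡ-+ (q 0) (κ₁ []) (κ₂ [])
alternateRow-+ᶠ (skip B)       q (p ∷ r) h = alternateRow-+ᶠ B q r (h ∘ (p ∷_))
alternateRow-+ᶠ (pick false B) q (p ∷ r) h = alternateRow-+ᶠ B q r (h ∘ (shift p ∷_))
alternateRow-+ᶠ (pick true B)  q (p ∷ r) h = ≡.trans
  (cong₂ _-_ (alternateRow-+ᶠ B (shift q) r (h ∘ (p ∷_))) (alternateRow-+ᶠ B q r (h ∘ (shift p ∷_))))
  (+-interchange-- (alternateRow B (shift q) r _) (alternateRow B (shift q) r _)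
                   (alternateRow B q r _) (alternateRow B q r _))

alternateRow-multilinear : ∀ {N : Vec Bool n} (B : Sub N) q {κ : Functional n} →
  Multilinear κ → Multilinear (λ r → alternateRow B q r κ)
alternateRow-multilinear (skip B) q {κ} lin (here h) = alternateRow-+ᶠ B q _ λ s → lin (here h)
alternateRow-multilinear (skip B) q {κ} lin (there s) =
  alternateRow-multilinear B q (lin ∘ there) s
alternateRow-multilinear (pick false B) q lin (here h) =
  alternateRow-+ᶠ B q _ λ s → lin (here (h ∘ suc))
alternateRow-multilinear (pick false B) q lin (there s) =
  alternateRow-multilinear B q (lin ∘ there) s
alternateRow-multilinear (pick true B) q lin (here h) = ≡.trans
  (cong₂ _-_ (alternateRow-+ᶠ B (shift q) _ λ s → lin (here h))
             (alternateRow-+ᶠ B q _ λ s → lin (here (h ∘ suc))))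
  (+-interchange-- (alternateRow B (shift q) _ _) (alternateRow B (shift q) _ _)
                   (alternateRow B q _ _) (alternateRow B q _ _))
alternateRow-multilinear (pick true B) q lin (there s) = ≡.trans
  (cong₂ _-_ (alternateRow-multilinear B (shift q) (lin ∘ there) s)
             (alternateRow-multilinear B q (lin ∘ there) s))
  (+-interchange-- (alternateRow B (shift q) _ _) (alternateRow B (shift q) _ _)
                   (alternateRow B q _ _) (alternateRow B q _ _))

alternate-multilinear : ∀ (M : Subgraph G) → Multilinear (alternate M)
alternate-multilinear (B ◃ M) (here h)  = alternateRow-+ˢ B _ (alternate M) h
alternate-multilinear (B ◃ M) (there s) = alternateRow-multilinear B _ (alternate-multilinear M) s

alternateRow-0ˢ : ∀ {N : Vec Bool n} (B : Sub N) {q} r (κ : Functional n) →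
  (∀ t → q t ≡ 0ℤ) → alternateRow B q r κ ≡ 0ℤ
alternateRow-0ˢ ∅ [] κ h rewrite h 0 = refl
alternateRow-0ˢ (skip B)       (p ∷ r) κ h = alternateRow-0ˢ B r _ h
alternateRow-0ˢ (pick false B) (p ∷ r) κ h = alternateRow-0ˢ B r _ h
alternateRow-0ˢ (pick true B)  (p ∷ r) κ h =
  cong₂ _-_ (alternateRow-0ˢ B r _ (h ∘ suc)) (alternateRow-0ˢ B r _ h)

alternateRow-0ᶠ : ∀ {N : Vec Bool n} (B : Sub N) q r {κ : Functional n} →
  (∀ s → κ s ≡ 0ℤ) → alternateRow B q r κ ≡ 0ℤ
alternateRow-0ᶠ ∅ q [] h rewrite h [] = ℤₚ.*-zeroʳ (q 0)
alternateRow-0ᶠ (skip B)       q (p ∷ r) h = alternateRow-0ᶠ B q r (h ∘ (p ∷_))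
alternateRow-0ᶠ (pick false B) q (p ∷ r) h = alternateRow-0ᶠ B q r (h ∘ (shift p ∷_))
alternateRow-0ᶠ (pick true B)  q (p ∷ r) h =
  cong₂ _-_ (alternateRow-0ᶠ B (shift q) r (h ∘ (p ∷_))) (alternateRow-0ᶠ B q r (h ∘ (shift p ∷_)))

-- κ computes k on polynomials whose degrees are small enough; c and e stand for the leading
-- coefficients and the degrees of the arguments already supplied.
record Represents (κ : Functional n) (k : Vec ℕ n → ℤ) (c : ℤ) (e μ : ℕ) : Set where
  field
    linear : Multilinear κ
    value  : ∀ {q f γ} → Degrees q f γ → e ℕ.+ Vec.sum f ℕ.≤ μ → κ q ≡ k f * (c * γ)
    vanish : ∀ f → e ℕ.+ Vec.sum f ℕ.< μ → k f ≡ 0ℤ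
open Represents

fix : ∀ {κ : Functional (suc n)} {k c e μ p x γ} → Represents κ k c e μ → HasDegree p x γ →
  Represents (κ ∘ (p ∷_)) (k ∘ (x ∷_)) (c * γ) (e ℕ.+ x) μ
fix R h .linear = R .linear ∘ there
fix {k = k} {c} {e} {x = x} {γ} R h .value {f = f} {δ} D le = ≡.trans
  (R .value (h ∷ D) (ℕₚ.≤-trans (ℕₚ.≤-reflexive (≡.sym (ℕₚ.+-assoc e x (Vec.sum f)))) le))
  (cong (λ z → k (x ∷ f) * z) (≡.sym (ℤₚ.*-assoc c γ δ)))
fix {e = e} {x = x} R h .vanish f lt =
  R .vanish (x ∷ f) (ℕₚ.≤-<-trans (ℕₚ.≤-reflexive (≡.sym (ℕₚ.+-assoc e x (Vec.sum f)))) lt)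

-- The zero sequence splits as 0 + 0, so the value z satisfies z = z + z.
linear-0 : ∀ {κ : Functional (suc n)} → Multilinear κ → ∀ {p} → (∀ t → p t ≡ 0ℤ) →
  ∀ s → κ (p ∷ s) ≡ 0ℤ
linear-0 {κ = κ} lin {p} h s = identityʳ-unique (κ (p ∷ s)) (κ (p ∷ s))
  (≡.sym (lin (here λ t → ≡.trans (h t) (≡.sym (cong₂ _+_ (h t) (h t))))))

-- With shift = id + Δ at both ends of an edge, the unshifted terms cancel, leaving Δ at the last
-- vertex minus Δ at the neighbour. This matches the signs of the edge variable in dᵥ and dᵤ. As Δ
-- lowers a degree by one and keeps the normalised leading coefficient, each edge uses up one
-- degree.
alternateRow-value : ∀ {N : Vec Bool n} (B : Sub N) {κ : Functional n} {k c e μ} →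
  Represents κ k c e μ → ∀ {q a α r f γ} → HasDegree q a α → Degrees r f γ →
  a ℕ.+ (e ℕ.+ Vec.sum f) ℕ.≤ size B ℕ.+ μ →
  alternateRow B q r κ ≡ below a (debit f k) B * (α * (c * γ))
alternateRow-value ∅ {κ} {k} {c} R {a = zero} {α} h [] le
  rewrite h 0 | R .value [] le = swap α (k []) (c * 1ℤ)
  where
  swap : ∀ x y z → x * (y * z) ≡ y * (x * z)
  swap = solve-∀
-- The row is exhausted while `q` still has positive degree, so the other arguments have total
-- degree below μ and `κ` vanishes on them, whatever `q 0` is.
alternateRow-value ∅ {κ} {k} {c} {e} R {q} {suc a} {α} h [] le = begin
  q 0 * κ []                  ≡⟨ cong (λ z → q 0 * z) (R .value [] (ℕₚ.<⇒≤ e<μ)) ⟩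
  q 0 * (k [] * (c * 1ℤ))     ≡⟨ cong (λ z → q 0 * (z * (c * 1ℤ))) (R .vanish [] e<μ) ⟩
  q 0 * (0ℤ * (c * 1ℤ))       ≡⟨ ℤₚ.*-zeroʳ (q 0) ⟩
  0ℤ                          ∎
  where
  open ≡-Reasoning
  e<μ = ℕₚ.≤-trans (s≤s (ℕₚ.m≤n+m _ a)) le
alternateRow-value (skip B) {k = k} {c} {e} R {a = a} {α} {f = x ∷ f} h
  (_∷_ {γ = γ} {δ = δ} d D) le =
  ≡.trans
    (alternateRow-value B (fix R d) h D
      (ℕₚ.≤-trans (ℕₚ.≤-reflexive (cong (a ℕ.+_) (ℕₚ.+-assoc e x (Vec.sum f)))) le))
    (cong (λ z → below a (debit f (k ∘ (x ∷_))) B * (α * z)) (ℤₚ.*-assoc c γ δ))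
-- The shift caused by an edge outside B changes neither the degree nor the leading coefficient of
-- `p`.
alternateRow-value (pick false B) {k = k} {c} {e} R {a = a} {α} {r = p ∷ _} {x ∷ f} h
  (_∷_ {γ = γ} {δ = δ} d D) le =
  ≡.trans
    (alternateRow-value B (fix R (shift-degree p x d)) h D
      (ℕₚ.≤-trans (ℕₚ.≤-reflexive (cong (a ℕ.+_) (ℕₚ.+-assoc e x (Vec.sum f)))) le))
    (cong (λ z → below a (debit f (k ∘ (x ∷_))) B * (α * z)) (ℤₚ.*-assoc c γ δ))
alternateRow-value {N = true ∷ N} (pick true B) {κ} {k} {c} {e} {μ} R {q} {a} {α} {p ∷ r} {x ∷ f} h
  (_∷_ {γ = γ} {δ = δ} d D) le = begin
  alternateRow B (shift q) r κₚ - alternateRow B q r κ₊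
    ≡⟨ cong₂ _-_ (alternateRow-+ˢ B r κₚ (λ t → shift-Δ q t))
                 (alternateRow-+ᶠ B q r (λ s → R .linear (here (shift-Δ p)))) ⟩
  (alternateRow B q r κₚ + alternateRow B (Δ q) r κₚ) -
  (alternateRow B q r κₚ + alternateRow B q r κ′)
    ≡⟨ cancel (alternateRow B q r κₚ) (alternateRow B (Δ q) r κₚ) (alternateRow B q r κ′) ⟩
  alternateRow B (Δ q) r κₚ - alternateRow B q r κ′
    ≡⟨ cong₂ _-_ (to-zero a h le) (to-neighbour x d le) ⟩
  taken a * w - - (below a (debit (x ∷ f) k ∘ pick true) B * w)
    ≡⟨ collect a ⟩
  below a (debit (x ∷ f) k) (pick true B) * w ∎
  where
  open ≡-Reasoning
  κₚ = κ ∘ (p ∷_)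
  κ₊ = κ ∘ (shift p ∷_)
  κ′ = κ ∘ (Δ p ∷_)
  w = α * (c * (γ * δ))

  shift-Δ : ∀ q t → q (suc t) ≡ q t + Δ q t
  shift-Δ q t = lemma (q (suc t)) (q t)
    where
    lemma : ∀ a b → a ≡ b + (a - b)
    lemma = solve-∀

  cancel : ∀ x y z → (x + y) - (x + z) ≡ y - z
  cancel = solve-∀

  -- The share of the terms in which the last vertex uses up a degree for the edge; for a = 0 there
  -- is none, as Δ q = 0.
  taken : ℕ → ℤ
  taken zero    = 0ℤ
  taken (suc a) = below a (debit f (k ∘ (x ∷_))) B

  collect : ∀ a → taken a * w - - (below a (debit (x ∷ f) k ∘ pick true) B * w) ≡
                  below a (debit (x ∷ f) k) (pick true B) * w
  collect zero    = lemma (below 0 (debit (x ∷ f) k ∘ pick true) B) w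
    where
    lemma : ∀ z w → 0ℤ * w - - (z * w) ≡ z * w
    lemma = solve-∀
  collect (suc a) = lemma (taken (suc a)) (below (suc a) (debit (x ∷ f) k ∘ pick true) B) w
    where
    lemma : ∀ y z w → y * w - - (z * w) ≡ (z + y) * w
    lemma = solve-∀

  to-zero : ∀ a → HasDegree q a α → a ℕ.+ (e ℕ.+ Vec.sum (x ∷ f)) ℕ.≤ suc (size B) ℕ.+ μ →
    alternateRow B (Δ q) r κₚ ≡ taken a * w
  to-zero zero    h le =
    alternateRow-0ˢ B r κₚ λ t → ℤₚ.i≡j⇒i-j≡0 (≡.trans (h (suc t)) (≡.sym (h t)))
  to-zero (suc a) h le = ≡.trans
    (alternateRow-value B (fix R d) h D
      (ℕₚ.≤-trans (ℕₚ.≤-reflexive (cong (a ℕ.+_) (ℕₚ.+-assoc e x (Vec.sum f)))) (ℕ.s≤s⁻¹ le)))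
    (cong (λ z → taken (suc a) * (α * z)) (ℤₚ.*-assoc c γ δ))

  -- The minus sign of the difference is the one in `debit`, and the zero clause of `debit`
  -- corresponds to Δ p = 0 for constant `p`.
  to-neighbour : ∀ x → HasDegree p x γ → a ℕ.+ (e ℕ.+ Vec.sum (x ∷ f)) ℕ.≤ suc (size B) ℕ.+ μ →
    alternateRow B q r κ′ ≡ - (below a (debit (x ∷ f) k ∘ pick true) B * w)
  to-neighbour zero d le = ≡.trans
    (alternateRow-0ᶠ B q r (linear-0 (R .linear) λ t →
      ℤₚ.i≡j⇒i-j≡0 (≡.trans (d (suc t)) (≡.sym (d t)))))
    (≡.sym (cong (λ z → - (z * w)) (below-≡0 a _ B λ _ _ → refl)))
  to-neighbour (suc x) d le = begin
    alternateRow B q r κ′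
      ≡⟨ alternateRow-value B (fix R d) h D (ℕ.s≤s⁻¹
           (ℕₚ.≤-trans (ℕₚ.≤-reflexive (move a e x (Vec.sum f))) le)) ⟩
    b * (α * (c * γ * δ))  ≡⟨ sign b α c γ δ ⟩
    - (- b * w)            ≡⟨ cong (λ z → - (z * w)) (below-neg a _ _ B λ _ → refl) ⟨
    - (below a (debit (suc x ∷ f) k ∘ pick true) B * w) ∎
    where
    b = below a (debit f (k ∘ (x ∷_))) B
    move : ∀ a e x s → suc (a ℕ.+ (e ℕ.+ x ℕ.+ s)) ≡ a ℕ.+ (e ℕ.+ (suc x ℕ.+ s))
    move = ℕ-Solver.solve-∀
    sign : ∀ b α c γ δ → b * (α * (c * γ * δ)) ≡ - (- b * (α * (c * (γ * δ))))
    sign = solve-∀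

-- The coefficient formula behind the Nullstellensatz; the factorials in γ cancel those divided out
-- in `coef`.
alternate-value : ∀ {G : Graph n} (M : Subgraph G) {q f γ} → Degrees q f γ →
  Vec.sum f ℕ.≤ edges M → alternate M q ≡ coef M f * γ
alternate-value ∅ [] le = refl
alternate-value (B ◃ M) {f = a ∷ f} (_∷_ {γ = γ} {δ = δ} h D) le = ≡.trans
  (alternateRow-value B represents h D le)
  (cong (λ z → below a (debit f (coef M)) B * (γ * z)) (ℤₚ.*-identityˡ δ))
  where
  represents : Represents (alternate M) (coef M) 1ℤ 0 (edges M)
  represents .linear = alternate-multilinear M
  represents .value {γ = γ} D le = ≡.trans (alternate-value M D le)
    (cong (λ z → coef M _ * z) (≡.sym (ℤₚ.*-identityˡ γ)))
  represents .vanish f lt = coef-≡0 M f (ℕₚ.<⇒≢ lt)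

-- Orientations

shift-outside : {N : Vec Bool n} → Sub N → Vec Sequence n → Vec Sequence n
shift-outside ∅              []      = []
shift-outside (skip X)       (p ∷ r) = p ∷ shift-outside X r
shift-outside (pick false X) (p ∷ r) = shift p ∷ shift-outside X r
shift-outside (pick true X)  (p ∷ r) = p ∷ shift-outside X r

-- A nonzero signed sum has a nonzero term; `X` collects the edges that this term directs to the
-- left.
alternateRow-≢0 : ∀ {N : Vec Bool n} (B : Sub N) q r (κ : Functional n) → alternateRow B q r κ ≢ 0ℤ →
  Σ (Sub N) λ X → q (size X) ≢ 0ℤ × κ (shift-outside X r) ≢ 0ℤ
alternateRow-≢0 ∅ q [] κ ne =
  ∅ , (λ e → ne (cong (λ z → z * κ []) e)) ,
      (λ e → ne (≡.trans (cong (λ z → q 0 * z) e) (ℤₚ.*-zeroʳ (q 0))))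
alternateRow-≢0 (skip B) q (p ∷ r) κ ne =
  let X , nz = alternateRow-≢0 B q r _ ne in skip X , nz
alternateRow-≢0 (pick false B) q (p ∷ r) κ ne =
  let X , nz = alternateRow-≢0 B q r _ ne in pick false X , nz
alternateRow-≢0 (pick true B) q (p ∷ r) κ ne with alternateRow B (shift q) r (κ ∘ (p ∷_)) ≟ 0ℤ
... | no nz = let X , nz′ = alternateRow-≢0 B (shift q) r _ nz in pick true X , nz′
... | yes e = let X , nz′ = alternateRow-≢0 B q r _ (λ e′ → ne (cong₂ _-_ e e′)) in pick false X , nz′

Nonvanishing : {G : Graph n} → Subgraph G → Vec Sequence n → Set
Nonvanishing ∅       []      = ⊤
Nonvanishing (X ◃ Y) (q ∷ r) = q (size X) ≢ 0ℤ × Nonvanishing Y (shift-outside X r)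

alternate-≢0 : ∀ {G : Graph n} (M : Subgraph G) r → alternate M r ≢ 0ℤ →
  Σ (Subgraph G) λ Y → Nonvanishing Y r
alternate-≢0 ∅       []      ne = ∅ , tt
alternate-≢0 (B ◃ M) (q ∷ r) ne =
  let X , nz , nz′ = alternateRow-≢0 B q r (alternate M) ne
      Y , nv       = alternate-≢0 M (shift-outside X r) nz′
  in X ◃ Y , nz , nv

-- The complement is taken within the row, so both are false at non-neighbours.
member nonmember : {N : Vec Bool n} → Sub N → Fin n → Bool
member (skip X)   zero    = false
member (pick b X) zero    = b
member (skip X)   (suc j) = member X j
member (pick b X) (suc j) = member X j
nonmember (skip X)   zero    = false
nonmember (pick b X) zero    = not b
nonmember (skip X)   (suc j) = nonmember X j
nonmember (pick b X) (suc j) = nonmember X j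

-- The edges of Y point to the left and the other edges of G to the right.
arrow : {G : Graph n} → Subgraph G → Fin n → Fin n → Bool
arrow (X ◃ Y) zero    zero    = false
arrow (X ◃ Y) zero    (suc j) = member X j
arrow (X ◃ Y) (suc i) zero    = nonmember X i
arrow (X ◃ Y) (suc i) (suc j) = arrow Y i j

card : (Fin n → Bool) → ℕ
card p = ∑ (bit ∘ p)

card-member : ∀ {N : Vec Bool n} (X : Sub N) → card (member X) ≡ size X
card-member ∅          = refl
card-member (skip X)   = card-member X
card-member (pick b X) = cong (bit b ℕ.+_) (card-member X)

lookup-shift-outside : ∀ {N : Vec Bool n} (X : Sub N) r i t →
  lookup (shift-outside X r) i t ≡ lookup r i (bit (nonmember X i) ℕ.+ t)
lookup-shift-outside (skip X)       (p ∷ r) zero    t = refl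
lookup-shift-outside (pick false X) (p ∷ r) zero    t = refl
lookup-shift-outside (pick true X)  (p ∷ r) zero    t = refl
lookup-shift-outside (skip X)       (p ∷ r) (suc i) t = lookup-shift-outside X r i t
lookup-shift-outside (pick false X) (p ∷ r) (suc i) t = lookup-shift-outside X r i t
lookup-shift-outside (pick true X)  (p ∷ r) (suc i) t = lookup-shift-outside X r i t

-- The shifts add up to the edges leaving i to the right, and the size of its own row in Y counts
-- those leaving to the left.
nonvanishing-lookup : ∀ {G : Graph n} (Y : Subgraph G) r → Nonvanishing Y r →
  ∀ i → lookup r i (card (arrow Y i)) ≢ 0ℤ
nonvanishing-lookup (X ◃ Y) (q ∷ r) (nz , nv) zero e =
  nz (≡.trans (cong q (≡.sym (card-member X))) e)
nonvanishing-lookup (X ◃ Y) (q ∷ r) (nz , nv) (suc i) e =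
  nonvanishing-lookup Y _ nv i (≡.trans (lookup-shift-outside X r i _) e)

-- Graphs and the degree condition from adjacency predicates

graph : (Fin n → Fin n → Bool) → Graph n
graph {zero}  g = ∅
graph {suc n} g = tabulate (g zero ∘ suc) ◃ graph (λ i j → g (suc i) (suc j))

sub : (p h : Fin n → Bool) → Sub (tabulate p)
sub {zero}  p h = ∅
sub {suc n} p h with p zero
... | true  = pick (h zero) (sub (p ∘ suc) (h ∘ suc))
... | false = skip (sub (p ∘ suc) (h ∘ suc))

subgraph : (g h : Fin n → Fin n → Bool) → Subgraph (graph g)
subgraph {zero}  g h = ∅
subgraph {suc n} g h =
  sub (g zero ∘ suc) (h zero ∘ suc) ◃ subgraph (λ i j → g (suc i) (suc j)) (λ i j → h (suc i) (suc j))

full-tabulate : ∀ (p : Fin n → Bool) → full (tabulate p) ≡ card p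
full-tabulate {zero}  p = refl
full-tabulate {suc n} p = cong (bit (p zero) ℕ.+_) (full-tabulate (p ∘ suc))

size-sub : ∀ (p h : Fin n → Bool) → (∀ j → h j ≡ true → p j ≡ true) → size (sub p h) ≡ card h
size-sub {zero}  p h h⊆p = refl
size-sub {suc n} p h h⊆p with p zero | h⊆p zero
... | true  | _ = cong (bit (h zero) ℕ.+_) (size-sub (p ∘ suc) (h ∘ suc) (h⊆p ∘ suc))
... | false | k with h zero
...   | false = size-sub (p ∘ suc) (h ∘ suc) (h⊆p ∘ suc)
...   | true  with () ← k refl

lower-sub : ∀ (p h : Fin n → Bool) f → (∀ j → h j ≡ true → p j ≡ true) →
  lower (tabulate f) (sub p h) ≡ tabulate (λ j → f j ∸ bit (h j))
lower-sub {zero}  p h f h⊆p = refl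
lower-sub {suc n} p h f h⊆p with p zero | h⊆p zero
... | true  | _ = cong (f zero ∸ bit (h zero) ∷_) (lower-sub (p ∘ suc) (h ∘ suc) (f ∘ suc) (h⊆p ∘ suc))
... | false | k with h zero
...   | false = cong (f zero ∷_) (lower-sub (p ∘ suc) (h ∘ suc) (f ∘ suc) (h⊆p ∘ suc))
...   | true  with () ← k refl

-- Index `zero` is the last vertex and an edge is stored in the row of its smaller index, so `after`
-- counts left neighbours and `before` right ones.
after before : (Fin n → Fin n → Bool) → Fin n → ℕ
after  g i = card (λ j → (toℕ i <ᵇ toℕ j) ∧ g i j)
before g i = card (λ j → (toℕ j <ᵇ toℕ i) ∧ g j i)

-- Each removed row lowers the exponents of its h-neighbours by one, and these iterated truncated
-- subtractions add up to the subtraction of `before h i`.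
subgraph-small : ∀ (g h : Fin n → Fin n → Bool) f → (∀ i j → h i j ≡ true → g i j ≡ true) →
  (∀ i → f i ∸ before h i ℕ.≤ after g i ∸ (after h i ℕ.+ after h i)) →
  Small (subgraph g h) (tabulate f)
subgraph-small {zero}  g h f h⊆g le = tt
subgraph-small {suc n} g h f h⊆g le = head , tail
  where
  g′ h′ : Fin n → Fin n → Bool
  g′ i j = g (suc i) (suc j)
  h′ i j = h (suc i) (suc j)

  row : Sub (tabulate (g zero ∘ suc))
  row = sub (g zero ∘ suc) (h zero ∘ suc)

  head : f zero ℕ.≤ full (tabulate (g zero ∘ suc)) ∸ (size row ℕ.+ size row)
  head rewrite full-tabulate (g zero ∘ suc)
             | size-sub (g zero ∘ suc) (h zero ∘ suc) (λ j → h⊆g zero (suc j)) =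
    -- No index precedes `zero`, so `before h zero` is a sum of zeros.
    ℕₚ.≤-trans (ℕₚ.≤-reflexive (cong (f zero ∸_) (≡.sym (sum-replicate-zero n)))) (le zero)

  tail : Small (subgraph g′ h′) (lower (tabulate (f ∘ suc)) row)
  tail rewrite lower-sub (g zero ∘ suc) (h zero ∘ suc) (f ∘ suc) (λ j → h⊆g zero (suc j)) =
    subgraph-small g′ h′ (λ j → f (suc j) ∸ bit (h zero (suc j))) (λ i j → h⊆g (suc i) (suc j))
      λ i → ℕₚ.≤-trans
        (ℕₚ.≤-reflexive (ℕₚ.∸-+-assoc (f (suc i)) (bit (h zero (suc i))) (before h′ i)))
        (le (suc i))

*-≢0 : ∀ {a b} → a ≢ 0ℤ → b ≢ 0ℤ → a * b ≢ 0ℤ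
*-≢0 {a} a≢0 b≢0 e with ℤₚ.i*j≡0⇒i≡0∨j≡0 a e
... | inj₁ a≡0 = a≢0 a≡0
... | inj₂ b≡0 = b≢0 b≡0

tabulate-degrees : ∀ (q : Fin n → Sequence) d (γ : Fin n → ℤ) →
  (∀ i → HasDegree (q i) (d i) (γ i)) → (∀ i → γ i ≢ 0ℤ) →
  ∃[ δ ] (δ ≢ 0ℤ × Degrees (tabulate q) (tabulate d) δ)
tabulate-degrees {zero}  q d γ h nz = 1ℤ , (λ ()) , []
tabulate-degrees {suc n} q d γ h nz =
  let δ , δ≢0 , D = tabulate-degrees (q ∘ suc) (d ∘ suc) (γ ∘ suc) (h ∘ suc) (nz ∘ suc)
  in γ zero * δ , *-≢0 (nz zero) δ≢0 , h zero ∷ D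

exists-nonvanishing : ∀ (g h : Fin n → Fin n → Bool) (q : Fin n → Sequence) d (γ : Fin n → ℤ) →
  (∀ i j → h i j ≡ true → g i j ≡ true) →
  (∀ i → HasDegree (q i) (d i) (γ i)) → (∀ i → γ i ≢ 0ℤ) →
  (∀ i → d i ∸ before h i ℕ.≤ after g i ∸ (after h i ℕ.+ after h i)) →
  Σ (Subgraph (graph g)) λ Y → ∀ i → q i (card (arrow Y i)) ≢ 0ℤ
exists-nonvanishing g h q d γ h⊆g deg γ≢0 le =
  let δ , δ≢0 , D = tabulate-degrees q d γ deg γ≢0
      M , c≢0     = exists-coef≢0 (subgraph g h) (tabulate d) (subgraph-small g h d h⊆g le)
      -- By homogeneity the nonzero coefficient makes the total degree equal to the number of edges
      -- of M, as the value formula requires.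
      Y , nv      = alternate-≢0 M (tabulate q) λ e → *-≢0 c≢0 δ≢0
        (≡.trans (≡.sym (alternate-value M D (ℕₚ.≤-reflexive (coef≢0⇒sum≡edges M (tabulate d) c≢0)))) e)
  in Y , λ i e → nonvanishing-lookup Y (tabulate q) nv i
    (≡.trans (cong (_$ card (arrow Y i)) (lookup∘tabulate q i)) e)

member⇒lookup : ∀ {N : Vec Bool n} (X : Sub N) j → member X j ≡ true → lookup N j ≡ true
member⇒lookup (pick b X) zero    e = refl
member⇒lookup (skip X)   (suc j) e = member⇒lookup X j e
member⇒lookup (pick b X) (suc j) e = member⇒lookup X j e

nonmember⇒lookup : ∀ {N : Vec Bool n} (X : Sub N) j → nonmember X j ≡ true → lookup N j ≡ true
nonmember⇒lookup (pick b X) zero    e = refl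
nonmember⇒lookup (skip X)   (suc j) e = nonmember⇒lookup X j e
nonmember⇒lookup (pick b X) (suc j) e = nonmember⇒lookup X j e

nonmember≡not-member : ∀ {N : Vec Bool n} (X : Sub N) j →
  lookup N j ≡ true → nonmember X j ≡ not (member X j)
nonmember≡not-member (pick b X) zero    e = refl
nonmember≡not-member (skip X)   (suc j) e = nonmember≡not-member X j e
nonmember≡not-member (pick b X) (suc j) e = nonmember≡not-member X j e

arrow⇒adjacent : ∀ (g : Fin n → Fin n → Bool) → (∀ i j → g i j ≡ g j i) → (Y : Subgraph (graph g)) →
  ∀ i j → arrow Y i j ≡ true → g i j ≡ true
arrow⇒adjacent {suc n} g g-sym (X ◃ Y) zero (suc j) e =
  ≡.trans (≡.sym (lookup∘tabulate (g zero ∘ suc) j)) (member⇒lookup X j e)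
arrow⇒adjacent {suc n} g g-sym (X ◃ Y) (suc i) zero e = ≡.trans (g-sym (suc i) zero)
  (≡.trans (≡.sym (lookup∘tabulate (g zero ∘ suc) i)) (nonmember⇒lookup X i e))
arrow⇒adjacent {suc n} g g-sym (X ◃ Y) (suc i) (suc j) e =
  arrow⇒adjacent (λ i j → g (suc i) (suc j)) (λ i j → g-sym (suc i) (suc j)) Y i j e

arrow-exactlyOne : ∀ (g : Fin n → Fin n → Bool) → (∀ i j → g i j ≡ g j i) → (∀ i → g i i ≡ false) →
  (Y : Subgraph (graph g)) → ∀ i j → g i j ≡ true → arrow Y i j ≡ not (arrow Y j i)
arrow-exactlyOne {suc n} g g-sym g-irr (X ◃ Y) zero zero e
  with () ← ≡.trans (≡.sym e) (g-irr zero)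
arrow-exactlyOne {suc n} g g-sym g-irr (X ◃ Y) zero (suc j) e = ≡.sym (≡.trans
  (cong not (nonmember≡not-member X j (≡.trans (lookup∘tabulate (g zero ∘ suc) j) e)))
  (not-involutive (member X j)))
arrow-exactlyOne {suc n} g g-sym g-irr (X ◃ Y) (suc i) zero e = nonmember≡not-member X i
  (≡.trans (lookup∘tabulate (g zero ∘ suc) i) (≡.trans (g-sym zero (suc i)) e))
arrow-exactlyOne {suc n} g g-sym g-irr (X ◃ Y) (suc i) (suc j) e =
  arrow-exactlyOne (λ i j → g (suc i) (suc j)) (λ i j → g-sym (suc i) (suc j)) (g-irr ∘ suc) Y i j e

-- Polynomials vanishing at the forbidden values

HasDegree-cong : ∀ d {p q : Sequence} {γ} → (∀ t → p t ≡ q t) → HasDegree p d γ → HasDegree q d γ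
HasDegree-cong zero    e h t = ≡.trans (≡.sym (e t)) (h t)
HasDegree-cong (suc d) e h   = HasDegree-cong d (λ t → cong₂ _-_ (e (suc t)) (e t)) h

HasDegree-+ : ∀ d {p q : Sequence} {γ δ} → HasDegree p d γ → HasDegree q d δ →
  HasDegree (λ t → p t + q t) d (γ + δ)
HasDegree-+ zero    h k t = cong₂ _+_ (h t) (k t)
HasDegree-+ (suc d) {p} {q} h k =
  HasDegree-cong d (λ t → lemma (p (suc t)) (p t) (q (suc t)) (q t)) (HasDegree-+ d h k)
  where
  lemma : ∀ a b c d → (a - b) + (c - d) ≡ (a + c) - (b + d)
  lemma = solve-∀

HasDegree-* : ∀ d a {q : Sequence} {γ} → HasDegree q d γ → HasDegree (λ t → a * q t) d (a * γ)
HasDegree-* zero    a h t = cong (λ z → a * z) (h t)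
HasDegree-* (suc d) a {q} h =
  HasDegree-cong d (λ t → distrib a (q (suc t)) (q t)) (HasDegree-* d a h)
  where
  distrib : ∀ a x y → a * (x - y) ≡ a * x - a * y
  distrib = solve-∀

affine : ℤ → ℤ → ℕ → ℤ
affine a b t = a * + t + b

-- By the Leibniz rule for Δ; the factor d + 1 is (d + 1)! / d!, since leading coefficients carry a
-- factorial.
HasDegree-affine-* : ∀ d a b {q : Sequence} {γ} → HasDegree q d γ →
  HasDegree (λ t → affine a b t * q t) (suc d) (+ suc d * (a * γ))
HasDegree-affine-* zero a b {q} {γ} h t
  rewrite h (suc t) | h t = lemma a b (+ t) γ
  where
  lemma : ∀ a b t γ → (a * (1ℤ + t) + b) * γ - (a * t + b) * γ ≡ 1ℤ * (a * γ)
  lemma = solve-∀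
HasDegree-affine-* (suc d) a b {q} {γ} h =
  ≡.subst (HasDegree (Δ (λ t → affine a b t * q t)) (suc d)) (combine (+ suc d) (a * γ))
    (HasDegree-cong (suc d) (λ t → leibniz a b (+ t) (q (suc t)) (q t))
      (HasDegree-+ (suc d) {p = λ t → affine a (a + b) t * Δ q t} {q = λ t → a * q t}
        (HasDegree-affine-* d a (a + b) h) (HasDegree-* (suc d) a {q} h)))
  where
  combine : ∀ d x → d * x + x ≡ (1ℤ + d) * x
  combine = solve-∀
  leibniz : ∀ a b t u v →
    (a * t + (a + b)) * (u - v) + a * v ≡ (a * (1ℤ + t) + b) * u - (a * t + b) * v
  leibniz = solve-∀

-- The polynomial placed at a vertex: its degree is the number of forbidden values, and it vanishes
-- at the out-degrees t for which a t + b is forbidden.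
avoid : ℤ → ℤ → List ℤ → Sequence
avoid a b []      t = 1ℤ
avoid a b (c ∷ F) t = affine a (b - c) t * avoid a b F t

avoid-degree : ∀ a b F → a ≢ 0ℤ → ∃[ γ ] (γ ≢ 0ℤ × HasDegree (avoid a b F) (length F) γ)
avoid-degree a b []      a≢0 = 1ℤ , (λ ()) , λ _ → refl
avoid-degree a b (c ∷ F) a≢0 =
  let γ , γ≢0 , h = avoid-degree a b F a≢0
  in + suc (length F) * (a * γ) ,
     *-≢0 {+ suc (length F)} (λ ()) (*-≢0 a≢0 γ≢0) ,
     HasDegree-affine-* (length F) a (b - c) h

avoid≢0⇒∉ : ∀ a b F t → avoid a b F t ≢ 0ℤ → affine a b t ∉ F
avoid≢0⇒∉ a b (c ∷ F) t ne (here e) = ne (cong (λ z → z * avoid a b F t)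
  (≡.trans (≡.sym (ℤₚ.+-assoc (a * + t) b (- c))) (ℤₚ.i≡j⇒i-j≡0 e)))
avoid≢0⇒∉ a b (c ∷ F) t ne (there m) = avoid≢0⇒∉ a b F t
  (λ e → ne (≡.trans (cong (λ z → affine a (b - c) t * z) e) (ℤₚ.*-zeroʳ (affine a (b - c) t)))) m

-- Degree counts and relabelling along the ordering

count≡card : ∀ (p : Fin n → Bool) → count p ≡ card p
count≡card p = go id
  where
  go : ∀ {m} (f : Fin m → Fin _) → length (filterᵇ p (List.tabulate f)) ≡ card (p ∘ f)
  go {zero}  f = refl
  go {suc m} f with p (f zero)
  ... | true  = cong suc (go (f ∘ suc))
  ... | false = go (f ∘ suc)

count-permute : ∀ (π : Permutation n n) (p : Fin n → Bool) → count p ≡ card (p ∘ (π ⟨$⟩ʳ_))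
count-permute π p = ≡.trans (count≡card p) (sum-permute (bit ∘ p) π)

opposite-<ᵇ : ∀ (i j : Fin n) → (toℕ (opposite i) <ᵇ toℕ (opposite j)) ≡ (toℕ j <ᵇ toℕ i)
opposite-<ᵇ {n} i j rewrite opposite-prop i | opposite-prop j = ⇔→≡ {z = true} (mk⇔
  (λ e → to T-≡ (ℕₚ.<⇒<ᵇ (ℕ.s<s⁻¹ (ℕₚ.∸-cancelʳ-<
    {suc (toℕ i)} {suc (toℕ j)} {n} (ℕₚ.<ᵇ⇒< _ _ (from T-≡ e))))))
  (λ e → to T-≡ (ℕₚ.<⇒<ᵇ (ℕₚ.∸-monoʳ-< {n} (s≤s (ℕₚ.<ᵇ⇒< _ _ (from T-≡ e))) (toℕ<n i)))))
  where open Equivalence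

outdeg+indeg : ∀ {n} (G : SimpleGraph n) D → IsOrientation G D → ∀ v →
  outdeg D v ℕ.+ indeg D v ≡ count (adj G v)
outdeg+indeg G D D-orient v = begin
  outdeg D v ℕ.+ indeg D v                   ≡⟨ cong₂ ℕ._+_ (count≡card (D v)) (count≡card (λ u → D u v)) ⟩
  card (D v) ℕ.+ card (λ u → D u v)          ≡⟨ ∑-distrib-+ (λ u → bit (D v u)) (λ u → bit (D u v)) ⟨
  ∑ (λ u → bit (D v u) ℕ.+ bit (D u v))      ≡⟨ sum-cong-≗ each ⟩
  card (adj G v)                             ≡⟨ count≡card (adj G v) ⟨
  count (adj G v)                            ∎
  where
  open ≡-Reasoning
  open IsOrientation D-orient
  each : ∀ u → bit (D v u) ℕ.+ bit (D u v) ≡ bit (adj G v u)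
  each u with adj G v u in a | D v u in vu | D u v in uv
  ... | true  | true  | false = refl
  ... | true  | false | true  = refl
  ... | true  | true  | true  with () ← ≡.trans (≡.sym vu) (≡.trans (exactlyOne v u a) (cong not uv))
  ... | true  | false | false with () ← ≡.trans (≡.sym vu) (≡.trans (exactlyOne v u a) (cong not uv))
  ... | false | true  | _     with () ← ≡.trans (≡.sym (onEdges v u vu)) a
  ... | false | false | true  with () ← ≡.trans (≡.sym (onEdges u v uv)) (≡.trans (SimpleGraph.sym G u v) a)
  ... | false | false | false = refl

-- Truncation only enlarges the right-hand difference, since L ≤ 2h + (L ∸ 2h).
ℤ-bound⇒ℕ-bound : ∀ l L h r → + l ≤ (+ L - + 2 * + h) + + r → l ∸ r ℕ.≤ L ∸ (h ℕ.+ h)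
ℤ-bound⇒ℕ-bound l L h r le = ℕₚ.m≤n+o⇒m∸n≤o l r (ℕₚ.+-cancelˡ-≤ (h ℕ.+ h) l _ (begin
  h ℕ.+ h ℕ.+ l                                 ≤⟨ ℤₚ.drop‿+≤+ shifted ⟩
  L ℕ.+ r                                       ≤⟨ ℕₚ.+-monoˡ-≤ r (ℕₚ.m≤n+m∸n L (h ℕ.+ h)) ⟩
  h ℕ.+ h ℕ.+ (L ∸ (h ℕ.+ h)) ℕ.+ r             ≡⟨ ℕₚ.+-assoc (h ℕ.+ h) (L ∸ (h ℕ.+ h)) r ⟩
  h ℕ.+ h ℕ.+ (L ∸ (h ℕ.+ h) ℕ.+ r)             ≡⟨ cong (h ℕ.+ h ℕ.+_) (ℕₚ.+-comm (L ∸ (h ℕ.+ h)) r) ⟩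
  h ℕ.+ h ℕ.+ (r ℕ.+ (L ∸ (h ℕ.+ h)))           ∎))
  where
  open ℕₚ.≤-Reasoning
  cancel : ∀ L h r → (h + h) + ((L - + 2 * h) + r) ≡ L + r
  cancel = solve-∀
  shifted : + (h ℕ.+ h ℕ.+ l) ≤ + (L ℕ.+ r)
  shifted = ≡.subst (λ z → + (h ℕ.+ h ℕ.+ l) ≤ z) (cancel (+ L) (+ h) (+ r))
    (ℤₚ.+-monoʳ-≤ (+ (h ℕ.+ h)) le)

module _ {n} (G H : SimpleGraph n) (F : Fin n → List ℤ) (ord : Fin n ⤖ Fin n)
  (H⊆G : IsSpanningSubgraph H G)
  (bound : ∀ v → + length (F v) ≤
    ((+ degL (Bijection.to ord) G v - + 2 * + degL (Bijection.to ord) H v)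
      + + degR (Bijection.to ord) H v))
  where

  private
    pos : Fin n → Fin n
    pos = Bijection.to ord

    -- The reversal gives index `zero` to the last vertex of the ordering, the one that is removed
    -- first.
    π : Permutation n n
    π = ⤖⇒↔ ord ∘ₚ Perm.reverse

    τ σ : Fin n → Fin n
    τ = π ⟨$⟩ʳ_
    σ = π ⟨$⟩ˡ_

    relabel : SimpleGraph n → Fin n → Fin n → Bool
    relabel K i j = adj K (σ i) (σ j)

    pos-<ᵇ : ∀ i j → (toℕ (pos (σ i)) <ᵇ toℕ (pos (σ j))) ≡ (toℕ j <ᵇ toℕ i)
    pos-<ᵇ i j = ≡.trans (≡.sym (opposite-<ᵇ (pos (σ j)) (pos (σ i))))
      (cong₂ (λ x y → toℕ x <ᵇ toℕ y) (Perm.inverseʳ π {j}) (Perm.inverseʳ π {i}))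

    degL≡after : ∀ K i → degL pos K (σ i) ≡ after (relabel K) i
    degL≡after K i = ≡.trans
      (count-permute (Perm.flip π) (λ u → adj K (σ i) u ∧ (toℕ (pos u) <ᵇ toℕ (pos (σ i)))))
      (sum-cong-≗ λ j →
      cong bit (≡.trans (∧-comm (relabel K i j) _) (cong (_∧ relabel K i j) (pos-<ᵇ j i))))

    degR≡before : ∀ K i → degR pos K (σ i) ≡ before (relabel K) i
    degR≡before K i = ≡.trans
      (count-permute (Perm.flip π) (λ u → adj K (σ i) u ∧ (toℕ (pos (σ i)) <ᵇ toℕ (pos u))))
      (sum-cong-≗ λ j →
      cong bit (≡.trans (∧-comm (relabel K i j) _)
        (cong₂ _∧_ (pos-<ᵇ i j) (SimpleGraph.sym K (σ i) (σ j)))))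

    bound′ : ∀ i → length (F (σ i)) ∸ before (relabel H) i ℕ.≤
      after (relabel G) i ∸ (after (relabel H) i ℕ.+ after (relabel H) i)
    bound′ i
      rewrite ≡.sym (degR≡before H i) | ≡.sym (degL≡after G i) | ≡.sym (degL≡after H i) =
      ℤ-bound⇒ℕ-bound _ (degL pos G (σ i)) (degL pos H (σ i)) _ (bound (σ i))

  -- Both readings of F forbid values of an affine function of the out-degree; the nonzero slope
  -- keeps the leading coefficients nonzero.
  exists-affine-avoiding : ∀ a (b : Fin n → ℤ) → a ≢ 0ℤ →
    ∃[ D ] (IsOrientation G D × (∀ v → affine a (b v) (outdeg D v) ∉ F v))
  exists-affine-avoiding a b a≢0 = D , orientation , avoiding
    where
    q : Fin n → Sequence
    q i = avoid a (b (σ i)) (F (σ i))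

    solution : Σ (Subgraph (graph (relabel G))) λ Y → ∀ i → q i (card (arrow Y i)) ≢ 0ℤ
    solution = exists-nonvanishing (relabel G) (relabel H) q (length ∘ F ∘ σ) _
      (λ i j → H⊆G (σ i) (σ j))
      (λ i → proj₂ (proj₂ (avoid-degree a (b (σ i)) (F (σ i)) a≢0)))
      (λ i → proj₁ (proj₂ (avoid-degree a (b (σ i)) (F (σ i)) a≢0)))
      bound′

    Y = proj₁ solution

    D : Fin n → Fin n → Bool
    D u v = arrow Y (τ u) (τ v)

    σ-τ : ∀ u v → relabel G (τ u) (τ v) ≡ adj G u v
    σ-τ u v = cong₂ (adj G) (Perm.inverseˡ π) (Perm.inverseˡ π)

    orientation : IsOrientation G D
    orientation .IsOrientation.onEdges u v e = ≡.trans (≡.sym (σ-τ u v))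
      (arrow⇒adjacent (relabel G) (λ i j → SimpleGraph.sym G (σ i) (σ j)) Y (τ u) (τ v) e)
    orientation .IsOrientation.exactlyOne u v e =
      arrow-exactlyOne (relabel G) (λ i j → SimpleGraph.sym G (σ i) (σ j)) (irrfl G ∘ σ) Y (τ u) (τ v)
        (≡.trans (σ-τ u v) e)

    avoiding : ∀ v → affine a (b v) (outdeg D v) ∉ F v
    avoiding v = ≡.subst (λ w → affine a (b w) (outdeg D v) ∉ F w) (Perm.inverseˡ π)
      (avoid≢0⇒∉ a (b (σ (τ v))) (F (σ (τ v))) (outdeg D v)
        (≡.subst (λ t → q (τ v) t ≢ 0ℤ)
          (≡.trans (sum-permute (bit ∘ arrow Y (τ v)) π) (≡.sym (count≡card (D v))))
          (proj₂ solution (τ v))))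

theorem6 : (n : ℕ) (G : SimpleGraph n) (F : Fin n → List ℤ) →
    (∀ v → Unique (F v)) →
    (Σ (Fin n ⤖ Fin n) λ ord → Σ (SimpleGraph n) λ H → IsSpanningSubgraph H G ×
    (∀ v → + length (F v) ≤
    ((+ degL (Bijection.to ord) G v - + 2 * + degL (Bijection.to ord) H v)
    + + degR (Bijection.to ord) H v))) →
    (∃[ D ] (IsOrientation G D × (∀ v → imbalance D v ∉ F v)))
    × (∃[ D ] (IsOrientation G D × (∀ v → + outdeg D v ∉ F v)))
theorem6 n G F _ (ord , H , H⊆G , bound) = by-imbalance , by-outdegree
  where
  by-imbalance : ∃[ D ] (IsOrientation G D × (∀ v → imbalance D v ∉ F v))
  by-imbalance =
    let D , D-orient , av =
          -- The imbalance is 2 deg⁺ - deg, because out-degree and in-degree add up to the degree.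
          exists-affine-avoiding G H F ord H⊆G bound (+ 2) (λ v → - + count (adj G v)) (λ ())
    in D , D-orient , λ v → ≡.subst (_∉ F v) (rearranged D D-orient v) (av v)
    where
    cancel : ∀ o i → + 2 * o + - (o + i) ≡ o - i
    cancel = solve-∀
    rearranged : ∀ D → IsOrientation G D → ∀ v →
      affine (+ 2) (- + count (adj G v)) (outdeg D v) ≡ imbalance D v
    rearranged D D-orient v rewrite ≡.sym (outdeg+indeg G D D-orient v) = cancel (+ outdeg D v) (+ indeg D v)

  by-outdegree : ∃[ D ] (IsOrientation G D × (∀ v → + outdeg D v ∉ F v))
  by-outdegree =
    let D , D-orient , av = exists-affine-avoiding G H F ord H⊆G bound 1ℤ (λ _ → 0ℤ) (λ ())
    in D , D-orient , λ v → ≡.subst (_∉ F v) (simplified (+ outdeg D v)) (av v)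
    where
    simplified : ∀ o → 1ℤ * o + 0ℤ ≡ o
    simplified = solve-∀
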